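{- Every word $\mathsf{u}\in\mathcal{A}$ admits a unique rightmost equitable partition, i.e. there exists exactly one equitable partition $\mathsf{u}^*$ of $\mathsf{u}$ such that every equitable partition $\mathsf{v}^*$ of $\mathsf{u}$ satisfies $\mathsf{block}(\mathsf{v}^*,i)\ge\mathsf{block}(\mathsf{u}^*,i)$ for all $1\le i\le N$.
   Context: Fix positive integers $m,N$. Let $\mathcal{A}$ be the set of words $\mathsf{u}=\mathsf{u}_1\cdots\mathsf{u}_N$ of length $N$ over $\{0,1,\ldots,m-1\}$; write $|\mathsf{u}|=\sum_i\mathsf{u}_i$ and $|\mathsf{u}|_m=|\mathsf{u}|\bmod m\in\{0,\ldots,m-1\}$. A partitioned word of $\mathsf{u}$ is a decomposition $\mathsf{u}^*=\mathsf{u}^*_{m-1}|\mathsf{u}^*_{m-2}|\cdots|\mathsf{u}^*_0$ of $\mathsf{u}$ into $m$ possibly empty consecutive factors (blocks) whose concatenation $\mathsf{u}^*_{m-1}\cdots\mathsf{u}^*_0$ is $\mathsf{u}$; write $\mathsf{block}(\mathsf{u}^*,i)=k$ if the $i$-th letter $\mathsf{u}_i$ lies in block $\mathsf{u}^*_k$. The balancing array of $\mathsf{u}^*$ is the $N\times m$ array with rows $i=1,\ldots,N$ and columns $j=m-1,\ldots,0$ whose entry $(i,j)$ is filled iff $j\equiv\mathsf{block}(\mathsf{u}^*,i)-t\pmod m$ for some $0\le t\le\mathsf{u}_i-1$. Column $j$ is equitably filled if it has exactly $\lfloor|\mathsf{u}|/m\rfloor+1$ filled entries when $1\le j\le|\mathsf{u}|_m$,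 and exactly $\lfloor|\mathsf{u}|/m\rfloor$ filled entries when $j=0$ or $j>|\mathsf{u}|_m$. $\mathsf{u}^*$ is an equitable partition if all its columns are equitably filled. -}

module Defs where

open import Data.Nat using (ℕ; zero; suc; _+_; _∸_; _≤_; _≥_; _<_; NonZero)
open import Data.Nat.DivMod using (_/_; _%_)
open import Data.Nat.Properties using (_≟_)
open import Data.Fin using (Fin; toℕ)
open import Data.Fin.Properties using (any?)
open import Data.List using (List; length; filter; map)
open import Data.Nat.ListAction using (sum)
open import Data.Sum using (_⊎_)
open import Data.List.Base using (allFin)
open import Data.Product using (Σ; ∃; _×_; _,_)
open import Relation.Binary.PropositionalEquality using (_≡_)
open import Relation.Nullary using (Dec)

Word : ℕ → ℕ → Set
Word m N = Fin N → Fin m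

weight : ∀ {m N} → Word m N → ℕ
weight {N = N} u = sum (map (λ i → toℕ (u i)) (allFin N))

-- A partitioned word u*_{m-1} | … | u*_0 into m possibly empty consecutive
-- blocks is the same as its block assignment i ↦ block(u*, i), which is
-- weakly decreasing along the word (letters earlier in u lie in blocks with
-- larger index).  Positions are 0-indexed here (Fin N).
record Partition (m N : ℕ) : Set where
  constructor mkPartition
  field
    block   : Fin N → Fin m
    antiton : ∀ (i k : Fin N) → toℕ i ≤ toℕ k → toℕ (block k) ≤ toℕ (block i)
open Partition public

-- Entry (i , j) of the balancing array is filled iff
-- j ≡ block(u*,i) - t (mod m) for some 0 ≤ t ≤ u_i - 1,
-- i.e. iff (j + t) mod m = block(u*,i) for some t < u_i.
Filled : ∀ {m N} .{{_ : NonZero m}} → Word m N → Partition m N → Fin N → Fin m → Set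
Filled u p i j = ∃ λ (t : Fin (toℕ (u i))) → (toℕ j + toℕ t) % _ ≡ toℕ (block p i)

filled? : ∀ {m N} .{{_ : NonZero m}} (u : Word m N) (p : Partition m N) (j : Fin m) (i : Fin N) →
          Dec (Filled u p i j)
filled? {m} u p j i = any? (λ t → ((toℕ j + toℕ t) % m) ≟ toℕ (block p i))

columnCount : ∀ {m N} .{{_ : NonZero m}} → Word m N → Partition m N → Fin m → ℕ
columnCount {N = N} u p j = length (filter (filled? u p j) (allFin N))

EquitableColumn : ∀ {m N} .{{_ : NonZero m}} → Word m N → Partition m N → Fin m → Set
EquitableColumn {m} u p j =
  ((1 ≤ toℕ j × toℕ j ≤ weight u % m) → columnCount u p j ≡ suc (weight u / m)) ×
  ((toℕ j ≡ 0 ⊎ weight u % m < toℕ j) → columnCount u p j ≡ weight u / m)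

Equitable : ∀ {m N} .{{_ : NonZero m}} → Word m N → Partition m N → Set
Equitable u p = ∀ j → EquitableColumn u p j

Rightmost : ∀ {m N} .{{_ : NonZero m}} → Word m N → Partition m N → Set
Rightmost {N = N} u p = ∀ (q : Partition _ N) → Equitable u q → ∀ i → toℕ (block q i) ≥ toℕ (block p i)

{-# OPTIONS --safe #-}
-- Start with every letter in block 0.  As long as some column k ≥ 1 has too
-- few filled entries, take the smallest such k and move the first letter of
-- block k-1 to block k.  Such a move adds one entry to column k and adds none
-- to any other column.
--
-- The blocks stay bounded by those of every equitable partition q: if the
-- moved letter were in a block < k of q, then column k of q would have at most
-- as many entries as the current column k, hence too few.
--
-- A column that is ever overfilled has never been raised, so all blocks lie to
-- the right of it and its count is at most that of column 0.  Hence if column 0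
-- is not overfilled, then no column is, and all counts are exact because they
-- add up to |u|.  This applies when no column k ≥ 1 is deficient; it also shows
-- that block k-1 is nonempty when column k is moved to, since otherwise column
-- k-1 has at most as many entries as column k, which forces k = 1 and column 0
-- not overfilled.
module Submission where

open import Defs
open import Data.Nat using (ℕ; zero; suc; _+_; _*_; _∸_; _≤_; _<_; z≤n; s≤s; NonZero; _≤?_; _<?_; >-nonZero⁻¹)
open import Data.Nat.Properties
open import Data.Nat.DivMod using (_/_; _%_; m≡m%n+[m/n]*n; m%n<n; m<n⇒m%n≡m; [m+n]%n≡m%n)
open import Data.Nat.Induction using (<-wellFounded)
open import Data.Nat.ListAction using () renaming (sum to sumList)
open import Data.Bool using (if_then_else_; true; false)
open import Data.Empty using (⊥)
open import Data.Fin using (Fin; zero; suc; toℕ; fromℕ<)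
open import Data.Fin.Properties using (toℕ<n; toℕ-injective; toℕ-fromℕ<; toℕ-inject; all?; ¬∀⟶∃¬-smallest) renaming (_≟_ to _≟ᶠ_)
open import Data.Fin.Permutation using (permutation)
open import Data.List using (length; filter; tabulate)
open import Data.List.Properties using (map-tabulate)
open import Data.Product using (Σ; ∃; _×_; _,_; proj₁; proj₂)
open import Data.Sum using (_⊎_; inj₁; inj₂)
open import Data.Unit using (⊤; tt)
open import Data.Vec.Functional using (updateAt)
open import Data.Vec.Functional.Properties using (updateAt-updates; updateAt-minimal)
open import Function using (_∘_; const; id)
open import Induction.WellFounded using (Acc; acc)
open import Relation.Binary.PropositionalEquality using (_≡_; _≢_; refl; sym; trans; cong; subst; module ≡-Reasoning)
open import Relation.Binary.Definitions using (tri<; tri≈; tri>)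
open import Relation.Nullary using (¬_; Dec; yes; no; does; contradiction)
open import Relation.Nullary.Decidable using (¬?)
open import Relation.Unary using (Pred; Decidable)
open import Algebra.Properties.CommutativeMonoid.Sum +-0-commutativeMonoid using (sum; ∑-comm; sum-permute; sum-cong-≗)

-- Least counterexamples, indicators and finite sums.

first-failure : ∀ {n p} {P : Pred (Fin n) p} → Decidable P →
                (∀ i → P i) ⊎ (∃ λ i → ¬ P i × (∀ j → toℕ j < toℕ i → P j))
first-failure {n} {P = P} P? with all? P?
... | yes all = inj₁ all
... | no ¬all with ¬∀⟶∃¬-smallest n P P? ¬all
...   | i , ¬Pi , below = inj₂ (i , ¬Pi , λ j j<i →
        subst P (toℕ-injective (trans (toℕ-inject (fromℕ< j<i)) (toℕ-fromℕ< j<i))) (below (fromℕ< j<i)))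

indicator : ∀ {a} {A : Set a} → Dec A → ℕ
indicator d = if does d then 1 else 0

indicator-mono : ∀ {a b} {A : Set a} {B : Set b} (d : Dec A) (e : Dec B) → (A → B) → indicator d ≤ indicator e
indicator-mono (no _)  _       _ = z≤n
indicator-mono (yes _) (yes _) _ = ≤-refl
indicator-mono (yes x) (no ¬y) f = contradiction (f x) ¬y

indicator-cong : ∀ {a b} {A : Set a} {B : Set b} (d : Dec A) (e : Dec B) → (A → B) → (B → A) → indicator d ≡ indicator e
indicator-cong d e f g = ≤-antisym (indicator-mono d e f) (indicator-mono e d g)

indicator≤1 : ∀ {a} {A : Set a} (d : Dec A) → indicator d ≤ 1
indicator≤1 (yes _) = ≤-refl
indicator≤1 (no _)  = z≤n

indicator-yes : ∀ {a} {A : Set a} (d : Dec A) → A → indicator d ≡ 1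
indicator-yes (yes _) _ = refl
indicator-yes (no ¬x) x = contradiction x ¬x

indicator-no : ∀ {a} {A : Set a} (d : Dec A) → ¬ A → indicator d ≡ 0
indicator-no (yes x) ¬x = contradiction x ¬x
indicator-no (no _)  _  = refl

sum-mono-≤ : ∀ {n} {f g : Fin n → ℕ} → (∀ i → f i ≤ g i) → sum f ≤ sum g
sum-mono-≤ {zero}  f≤g = z≤n
sum-mono-≤ {suc n} f≤g = +-mono-≤ (f≤g zero) (sum-mono-≤ (f≤g ∘ suc))

sum-mono-< : ∀ {n} {f g : Fin n → ℕ} → (∀ i → f i ≤ g i) → ∀ i → f i < g i → sum f < sum g
sum-mono-< {suc n} f≤g zero    fi<gi = +-mono-<-≤ fi<gi (sum-mono-≤ (f≤g ∘ suc))
sum-mono-< {suc n} f≤g (suc i) fi<gi = +-mono-≤-< (f≤g zero) (sum-mono-< (f≤g ∘ suc) i fi<gi)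

sum-≤-≡ : ∀ {n} {f g : Fin n → ℕ} → (∀ i → f i ≤ g i) → sum f ≡ sum g → ∀ i → f i ≡ g i
sum-≤-≡ f≤g eq i with m≤n⇒m<n∨m≡n (f≤g i)
... | inj₁ fi<gi = contradiction eq (<⇒≢ (sum-mono-< f≤g i fi<gi))
... | inj₂ fi≡gi = fi≡gi

sum-≤-suc : ∀ {n} {f g : Fin n → ℕ} i → (∀ j → j ≢ i → f j ≤ g j) → f i ≤ suc (g i) → sum f ≤ suc (sum g)
sum-≤-suc {suc n} zero    f≤g fi≤ = +-mono-≤ fi≤ (sum-mono-≤ λ j → f≤g (suc j) λ ())
sum-≤-suc {suc n} {f} {g} (suc i) f≤g fi≤ =
  ≤-trans (+-mono-≤ (f≤g zero λ ()) (sum-≤-suc i (λ j j≢i → f≤g (suc j) λ { refl → j≢i refl }) fi≤))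
          (≤-reflexive (+-suc (g zero) _))

sum-const-+ : ∀ {n} c (f : Fin n → ℕ) → sum (λ i → c + f i) ≡ n * c + sum f
sum-const-+ {zero}  c f = refl
sum-const-+ {suc n} c f = begin
  (c + f zero) + sum (λ i → c + f (suc i)) ≡⟨ cong ((c + f zero) +_) (sum-const-+ c (f ∘ suc)) ⟩
  (c + f zero) + (n * c + sum (f ∘ suc))   ≡⟨ +-assoc c (f zero) _ ⟩
  c + (f zero + (n * c + sum (f ∘ suc)))   ≡⟨ cong (c +_) (+-assoc (f zero) (n * c) _) ⟨
  c + (f zero + n * c + sum (f ∘ suc))     ≡⟨ cong (λ x → c + (x + sum (f ∘ suc))) (+-comm (f zero) (n * c)) ⟩
  c + (n * c + f zero + sum (f ∘ suc))     ≡⟨ cong (c +_) (+-assoc (n * c) (f zero) _) ⟩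
  c + (n * c + sum f)                      ≡⟨ +-assoc c (n * c) _ ⟨
  suc n * c + sum f                        ∎
  where open ≡-Reasoning

sum-indicator-< : ∀ {n a} → a ≤ n → sum {n} (λ i → indicator (toℕ i <? a)) ≡ a
sum-indicator-< {zero}  z≤n = refl
sum-indicator-< {suc n} {zero} z≤n = trans
  (sum-cong-≗ {n} λ i → indicator-cong (suc (toℕ i) <? 0) (toℕ i <? 0) (λ ()) (λ ()))
  (sum-indicator-< {n} {0} z≤n)
sum-indicator-< {suc n} {suc a} (s≤s a≤n) = cong suc (trans
  (sum-cong-≗ {n} λ i → indicator-cong (suc (toℕ i) <? suc a) (toℕ i <? a) (λ { (s≤s p) → p }) s≤s)
  (sum-indicator-< a≤n))

sumList-tabulate : ∀ {n} (f : Fin n → ℕ) → sumList (tabulate f) ≡ sum f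
sumList-tabulate {zero}  f = refl
sumList-tabulate {suc n} f = cong (f zero +_) (sumList-tabulate (f ∘ suc))

length-filter-tabulate : ∀ {n a p} {A : Set a} {P : Pred A p} (P? : Decidable P) (f : Fin n → A) →
                         length (filter P? (tabulate f)) ≡ sum (λ i → indicator (P? (f i)))
length-filter-tabulate {zero}  P? f = refl
length-filter-tabulate {suc n} P? f with does (P? (f zero))
... | true  = cong suc (length-filter-tabulate P? (f ∘ suc))
... | false = length-filter-tabulate P? (f ∘ suc)

-- Differences modulo `m`.

-- The representative of b − j modulo m in {0, …, m-1}, for b , j < m.
gap : ℕ → ℕ → ℕ → ℕ
gap m b j with j ≤? b
... | yes _ = b ∸ j
... | no  _ = b + (m ∸ j)

module _ {m b j : ℕ} where

  gap-≤ : j ≤ b → gap m b j ≡ b ∸ j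
  gap-≤ j≤b with j ≤? b
  ... | yes _  = refl
  ... | no j≰b = contradiction j≤b j≰b

  gap-> : b < j → gap m b j ≡ b + (m ∸ j)
  gap-> b<j with j ≤? b
  ... | yes j≤b = contradiction j≤b (<⇒≱ b<j)
  ... | no  _   = refl

gap<m : ∀ {m b j} → b < m → j < m → gap m b j < m
gap<m {m} {b} {j} b<m j<m with j ≤? b
... | yes _  = ≤-<-trans (m∸n≤m b j) b<m
... | no j≰b = <-≤-trans (+-monoˡ-< (m ∸ j) (≰⇒> j≰b)) (≤-reflexive (m+[n∸m]≡n (<⇒≤ j<m)))

gap-involutive : ∀ {m b j} → j < m → gap m b (gap m b j) ≡ j
gap-involutive {m} {b} {j} j<m with j ≤? b
... | yes j≤b = trans (gap-≤ (m∸n≤m b j)) (m∸[m∸n]≡n j≤b)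
... | no j≰b = trans (gap-> (m<m+n b (m<n⇒0<n∸m j<m))) (begin
  b + (m ∸ (b + (m ∸ j))) ≡⟨ cong (λ x → b + (m ∸ x)) (+-comm b (m ∸ j)) ⟩
  b + (m ∸ ((m ∸ j) + b)) ≡⟨ cong (b +_) (∸-+-assoc m (m ∸ j) b) ⟨
  b + (m ∸ (m ∸ j) ∸ b)   ≡⟨ cong (λ x → b + (x ∸ b)) (m∸[m∸n]≡n (<⇒≤ j<m)) ⟩
  b + (j ∸ b)             ≡⟨ m+[n∸m]≡n (<⇒≤ (≰⇒> j≰b)) ⟩
  j                       ∎)
  where open ≡-Reasoning

-- The side condition keeps `b` and `c` on the same side of `j`, so both gaps come from the same
-- branch. Stepping from `j - 1` onto `j` would instead drop the gap to 0.
gap-mono-≤ : ∀ {m b c j} → b ≤ c → j ≤ b ⊎ c < j → gap m b j ≤ gap m c j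
gap-mono-≤ {m} {b} {c} {j} b≤c (inj₁ j≤b)
  rewrite gap-≤ {m} j≤b | gap-≤ {m} (≤-trans j≤b b≤c) = ∸-monoˡ-≤ j b≤c
gap-mono-≤ {m} {b} {c} {j} b≤c (inj₂ c<j)
  rewrite gap-> {m} (≤-<-trans b≤c c<j) | gap-> {m} c<j = +-monoˡ-≤ (m ∸ j) b≤c

-- The difference `b - j` falls by one with each column; it wraps from 0 back up only on leaving
-- `j = b`.
gap-suc-≤ : ∀ {m b j} → b ≢ j → gap m b (suc j) ≤ gap m b j
gap-suc-≤ {m} {b} {j} b≢j with <-cmp b j
... | tri< b<j _ _ rewrite gap-> {m} b<j | gap-> {m} (m≤n⇒m≤1+n b<j) = +-monoʳ-≤ b (∸-monoʳ-≤ m (n≤1+n j))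
... | tri≈ _ b≡j _ = contradiction b≡j b≢j
... | tri> _ _ j<b rewrite gap-≤ {m} j<b | gap-≤ {m} (<⇒≤ j<b) = ∸-monoʳ-≤ b (n≤1+n j)

gap-zero-≤ : ∀ {m b j} → b < j → gap m b 0 ≤ gap m b j
gap-zero-≤ {m} {b} {j} b<j rewrite gap-> {m} b<j = m≤m+n b (m ∸ j)

module _ {m : ℕ} .{{_ : NonZero m}} {b j : ℕ} (b<m : b < m) (j<m : j < m) where

  [j+gap]%m≡b : (j + gap m b j) % m ≡ b
  [j+gap]%m≡b with j ≤? b
  ... | yes j≤b = trans (cong (_% m) (m+[n∸m]≡n j≤b)) (m<n⇒m%n≡m b<m)
  ... | no  _   = trans (cong (_% m) eq) (trans ([m+n]%n≡m%n b m) (m<n⇒m%n≡m b<m))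
    where
    open ≡-Reasoning
    eq : j + (b + (m ∸ j)) ≡ b + m
    eq = begin
      j + (b + (m ∸ j)) ≡⟨ +-comm j _ ⟩
      b + (m ∸ j) + j   ≡⟨ +-assoc b (m ∸ j) j ⟩
      b + (m ∸ j + j)   ≡⟨ cong (b +_) (m∸n+n≡m (<⇒≤ j<m)) ⟩
      b + m             ∎

  [j+t]%m≡b⇒gap≡t : ∀ {t} → t < m → (j + t) % m ≡ b → gap m b j ≡ t
  [j+t]%m≡b⇒gap≡t {t} t<m eq with j + t <? m
  ... | yes j+t<m = trans (gap-≤ (≤-trans (m≤m+n j t) (≤-reflexive j+t≡b)))
                          (trans (cong (_∸ j) (sym j+t≡b)) (m+n∸m≡n j t))
    where
    j+t≡b : j + t ≡ b
    j+t≡b = trans (sym (m<n⇒m%n≡m j+t<m)) eq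
  ... | no j+t≮m = trans (gap-> b<j) (begin
    b + (m ∸ j) ≡⟨ +-∸-assoc b (<⇒≤ j<m) ⟨
    b + m ∸ j   ≡⟨ cong (_∸ j) b+m≡j+t ⟩
    j + t ∸ j   ≡⟨ m+n∸m≡n j t ⟩
    t           ∎)
    where
    open ≡-Reasoning
    c : ℕ
    c = j + t ∸ m
    c+m≡j+t : c + m ≡ j + t
    c+m≡j+t = m∸n+n≡m (≮⇒≥ j+t≮m)
    -- As `t < m`, the sum `j + t` wraps at most once, and its remainder `c` lands strictly below
    -- `j`; so `c` is reduced and must be `b`.
    c<j : c < j
    c<j = +-cancelʳ-< m c j (subst (_< j + m) (sym c+m≡j+t) (+-monoʳ-< j t<m))
    c≡b : c ≡ b
    c≡b = trans (sym (m<n⇒m%n≡m (<-trans c<j j<m)))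
          (trans (sym ([m+n]%n≡m%n c m)) (trans (cong (_% m) c+m≡j+t) eq))
    b<j : b < j
    b<j = subst (_< j) c≡b c<j
    b+m≡j+t : b + m ≡ j + t
    b+m≡j+t = trans (cong (_+ m) (sym c≡b)) c+m≡j+t

-- The reflection `j ↦ b - j` modulo `m` is an involution, so summing over gaps is summing over
-- columns. Hence a letter `a` fills `a` columns whatever its block.
sum-indicator-gap : ∀ {m b a} → b < m → a ≤ m → sum {m} (λ j → indicator (gap m b (toℕ j) <? a)) ≡ a
sum-indicator-gap {m} {b} {a} b<m a≤m = begin
  sum {m} (λ j → indicator (gap m b (toℕ j) <? a)) ≡⟨ sum-cong-≗ {m} (λ j → cong (λ x → indicator (x <? a)) (toℕ-reflect j)) ⟨
  sum {m} (λ j → indicator (toℕ (reflect j) <? a)) ≡⟨ sum-permute (λ j → indicator (toℕ j <? a)) (permutation reflect reflect involutive involutive) ⟨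
  sum {m} (λ j → indicator (toℕ j <? a))           ≡⟨ sum-indicator-< a≤m ⟩
  a                                                ∎
  where
  open ≡-Reasoning
  reflect : Fin m → Fin m
  reflect j = fromℕ< (gap<m b<m (toℕ<n j))
  toℕ-reflect : ∀ j → toℕ (reflect j) ≡ gap m b (toℕ j)
  toℕ-reflect j = toℕ-fromℕ< (gap<m b<m (toℕ<n j))
  involutive : ∀ j → reflect (reflect j) ≡ j
  involutive j = toℕ-injective (trans (toℕ-reflect (reflect j))
    (trans (cong (gap m b) (toℕ-reflect j)) (gap-involutive (toℕ<n j))))

-- Equitable column heights.

module _ (f r : ℕ) where

  -- Here `f` and `r` stand for quotient and remainder of the weight by `m`. Column 0 never gets an
  -- extra entry; for column `suc j` the test `j <? r` says `suc j ≤ r`.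
  target : ℕ → ℕ
  target zero    = f
  target (suc j) = f + indicator (j <? r)

  target-full : ∀ {j} → 1 ≤ j → j ≤ r → target j ≡ suc f
  target-full {suc j} _ j<r = trans (cong (f +_) (indicator-yes (j <? r) j<r)) (+-comm f 1)

  target-base : ∀ {j} → j ≡ 0 ⊎ r < j → target j ≡ f
  target-base {zero}  _ = refl
  target-base {suc j} (inj₂ (s≤s r≤j)) = trans (cong (f +_) (indicator-no (j <? r) (≤⇒≯ r≤j))) (+-identityʳ f)

  f≤target : ∀ j → f ≤ target j
  f≤target zero    = ≤-refl
  f≤target (suc j) = m≤m+n f _

  target-1-≤ : target 1 ≤ suc f
  target-1-≤ = ≤-trans (+-monoʳ-≤ f (indicator≤1 (0 <? r))) (≤-reflexive (+-comm f 1))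

  -- Starts at column 1, because the target may rise from column 0 to column 1.
  target-antitone : ∀ j → target (2 + j) ≤ target (1 + j)
  target-antitone j = +-monoʳ-≤ f (indicator-mono (suc j <? r) (j <? r) (<-trans (n<1+n j)))

  -- With `r < m`, all `r` extra entries fit into the `m - 1` columns other than 0.
  sum-target : ∀ {m} → r < m → sum {m} (target ∘ toℕ) ≡ m * f + r
  sum-target {suc m} (s≤s r≤m) = begin
    f + sum {m} (λ j → f + indicator (toℕ j <? r))       ≡⟨ cong (f +_) (sum-const-+ {m} f _) ⟩
    f + (m * f + sum {m} (λ j → indicator (toℕ j <? r))) ≡⟨ +-assoc f (m * f) _ ⟨
    suc m * f + sum {m} (λ j → indicator (toℕ j <? r))   ≡⟨ cong (suc m * f +_) (sum-indicator-< r≤m) ⟩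
    suc m * f + r                                        ∎
    where open ≡-Reasoning

-- Column counts of a partition and their targets.

module _ {m N : ℕ} .{{_ : NonZero m}} (u : Word m N) where

  blockℕ : Partition m N → Fin N → ℕ
  blockℕ p i = toℕ (block p i)

  filled : Partition m N → ℕ → Fin N → ℕ
  filled p j i = indicator (gap m (blockℕ p i) j <? toℕ (u i))

  column : Partition m N → ℕ → ℕ
  column p j = sum (filled p j)

  quot rem : ℕ
  quot = weight u / m
  rem = weight u % m

  goal : ℕ → ℕ
  goal = target quot rem

  filled-mono : ∀ {p q j k} i → gap m (blockℕ q i) k ≤ gap m (blockℕ p i) j → filled p j i ≤ filled q k i
  filled-mono {p} {q} {j} {k} i le =
    indicator-mono (gap m (blockℕ p i) j <? toℕ (u i)) (gap m (blockℕ q i) k <? toℕ (u i)) (≤-<-trans le)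

  columnCount≡column : ∀ p j → columnCount u p j ≡ column p (toℕ j)
  columnCount≡column p j = trans (length-filter-tabulate (filled? u p j) id)
    (sum-cong-≗ λ i → indicator-cong (filled? u p j i) (gap m (blockℕ p i) (toℕ j) <? toℕ (u i)) (to i) (from i))
    where
    to : ∀ i → Filled u p i j → gap m (blockℕ p i) (toℕ j) < toℕ (u i)
    -- A letter is below `m`, hence so is `t`, which must then be the gap.
    to i (t , eq) = subst (_< toℕ (u i))
      (sym ([j+t]%m≡b⇒gap≡t (toℕ<n (block p i)) (toℕ<n j) (<-trans (toℕ<n t) (toℕ<n (u i))) eq)) (toℕ<n t)
    from : ∀ i → gap m (blockℕ p i) (toℕ j) < toℕ (u i) → Filled u p i j
    from i lt = fromℕ< lt ,
      trans (cong (λ t → (toℕ j + t) % m) (toℕ-fromℕ< lt)) ([j+gap]%m≡b (toℕ<n (block p i)) (toℕ<n j))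

  equitable⇒column≡goal : ∀ {p} → Equitable u p → ∀ (j : Fin m) → column p (toℕ j) ≡ goal (toℕ j)
  equitable⇒column≡goal {p} eq j with 1 ≤? toℕ j | toℕ j ≤? rem
  ... | yes 1≤j | yes j≤r = trans (sym (columnCount≡column p j))
                              (trans (proj₁ (eq j) (1≤j , j≤r)) (sym (target-full quot rem 1≤j j≤r)))
  ... | no 1≰j  | _       = trans (sym (columnCount≡column p j))
                              (trans (proj₂ (eq j) (inj₁ (n<1⇒n≡0 (≰⇒> 1≰j)))) (sym (target-base quot rem (inj₁ (n<1⇒n≡0 (≰⇒> 1≰j))))))
  ... | _       | no j≰r  = trans (sym (columnCount≡column p j))
                              (trans (proj₂ (eq j) (inj₂ (≰⇒> j≰r))) (sym (target-base quot rem (inj₂ (≰⇒> j≰r)))))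

  column≡goal⇒equitable : ∀ {p} → (∀ (j : Fin m) → column p (toℕ j) ≡ goal (toℕ j)) → Equitable u p
  column≡goal⇒equitable {p} eq j =
    (λ (1≤j , j≤r) → trans (columnCount≡column p j) (trans (eq j) (target-full quot rem 1≤j j≤r))) ,
    (λ h → trans (columnCount≡column p j) (trans (eq j) (target-base quot rem h)))

  -- Double counting: summed by rows, the filled entries number `weight u`, independently of the
  -- partition.
  sum-column≡sum-goal : ∀ p → sum {m} (column p ∘ toℕ) ≡ sum {m} (goal ∘ toℕ)
  sum-column≡sum-goal p = begin
    sum {m} (λ j → sum (λ i → filled p (toℕ j) i)) ≡⟨ ∑-comm (λ (j : Fin m) i → filled p (toℕ j) i) ⟩
    sum (λ i → sum {m} (λ j → filled p (toℕ j) i)) ≡⟨ sum-cong-≗ (λ i → sum-indicator-gap (toℕ<n (block p i)) (<⇒≤ (toℕ<n (u i)))) ⟩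
    sum (λ i → toℕ (u i))                          ≡⟨ sumList-tabulate {N} _ ⟨
    sumList (tabulate (λ i → toℕ (u i)))           ≡⟨ cong sumList (map-tabulate id (λ i → toℕ (u i))) ⟨
    weight u                                       ≡⟨ m≡m%n+[m/n]*n (weight u) m ⟩
    rem + quot * m                                 ≡⟨ +-comm rem (quot * m) ⟩
    quot * m + rem                                 ≡⟨ cong (_+ rem) (*-comm quot m) ⟩
    m * quot + rem                                 ≡⟨ sum-target quot rem (m%n<n (weight u) m) ⟨
    sum {m} (goal ∘ toℕ)                           ∎
    where open ≡-Reasoning

  -- The invariant of the moves: a column is in the first case until some letter is raised into it,
  -- and in the second from then on.
  Controlled : Partition m N → Set
  Controlled p = ∀ j → j < m → 1 ≤ j → (∀ i → blockℕ p i < j) ⊎ column p j ≤ goal j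

  -- A column with all blocks to its right has at most as many entries as column 0. So no column
  -- exceeds its goal, and equal totals force equality.
  column-zero-≤⇒exact : ∀ {p} → Controlled p → column p 0 ≤ goal 0 → ∀ (j : Fin m) → column p (toℕ j) ≡ goal (toℕ j)
  column-zero-≤⇒exact {p} ctrl c₀≤ = sum-≤-≡ (λ j → bound (toℕ j) (toℕ<n j)) (sum-column≡sum-goal p)
    where
    bound : ∀ j → j < m → column p j ≤ goal j
    bound zero    _   = c₀≤
    bound (suc j) j<m with ctrl (suc j) j<m (s≤s z≤n)
    ... | inj₂ c≤ = c≤
    ... | inj₁ b< = ≤-trans (sum-mono-≤ λ i → filled-mono {p} {p} {suc j} {0} i (gap-zero-≤ {m} (b< i)))
                            (≤-trans c₀≤ (f≤target quot rem (suc j)))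

  -- Column 0 counts as sated because no move can fill it: there is no block to its right.
  Sated : Partition m N → ℕ → Set
  Sated p zero    = ⊤
  Sated p (suc j) = goal (suc j) ≤ column p (suc j)

  sated? : ∀ p j → Dec (Sated p j)
  sated? p zero    = yes tt
  sated? p (suc j) = goal (suc j) ≤? column p (suc j)

  sated⇒exact : ∀ {p} → Controlled p → (∀ (j : Fin m) → Sated p (toℕ j)) → ∀ (j : Fin m) → column p (toℕ j) ≡ goal (toℕ j)
  sated⇒exact {p} ctrl sated with column p 0 ≤? goal 0
  ... | yes c₀≤ = column-zero-≤⇒exact {p} ctrl c₀≤
  -- Now every column, 0 included, reaches its goal, and equal totals again force equality.
  ... | no c₀≰ = sym ∘ sum-≤-≡ (λ j → bound (toℕ j) (sated j)) (sym (sum-column≡sum-goal p))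
    where
    bound : ∀ j → Sated p j → goal j ≤ column p j
    bound zero    _  = <⇒≤ (≰⇒> c₀≰)
    bound (suc j) le = le

  -- With block `k` empty, no gap wraps between columns `k` and `suc k`, so column `k` has at most
  -- as many entries as column `suc k`.
  deficient⇒block-nonempty : ∀ {p} → Controlled p → ∀ {k} → suc k < m → column p (suc k) < goal (suc k) →
    Sated p k → ¬ (∀ i → blockℕ p i ≢ k)
  deficient⇒block-nonempty {p} ctrl {k} k<m deficient sated empty = absurd k k<m deficient sated
    (sum-mono-≤ λ i → filled-mono {p} {p} {k} {suc k} i (gap-suc-≤ {m} (empty i)))
    where
    absurd : ∀ k → suc k < m → column p (suc k) < goal (suc k) → Sated p k → column p k ≤ column p (suc k) → ⊥
    -- Column 1 has at most `quot` entries, hence so has column 0; then all columns are exact,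
    -- column 1 among them.
    absurd zero 1<m c₁< _ c₀≤c₁ = <⇒≢ c₁< (subst (λ j → column p j ≡ goal j) (toℕ-fromℕ< 1<m)
      (column-zero-≤⇒exact {p} ctrl (≤-pred (<-≤-trans (≤-<-trans c₀≤c₁ c₁<) (target-1-≤ quot rem))) (fromℕ< 1<m)))
    -- From column 1 on the goals decrease weakly, so the sated column on the right has more entries
    -- than the deficient one.
    absurd (suc k) _ c< sated c≤ = <-irrefl refl
      (≤-<-trans c≤ (<-≤-trans c< (≤-trans (target-antitone quot rem k) sated)))

  -- Moving the first letter of block `k` to block `suc k`.

  module Raise (p : Partition m N) (i : Fin N) {k : ℕ} (k<m : suc k < m) (bᵢ≡k : blockℕ p i ≡ k)
               (left : ∀ i′ → toℕ i′ < toℕ i → suc k ≤ blockℕ p i′) where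

    raised : Fin N → Fin m
    raised = updateAt (block p) i (const (fromℕ< k<m))

    raised-at : toℕ (raised i) ≡ suc k
    raised-at = trans (cong toℕ (updateAt-updates i (block p))) (toℕ-fromℕ< k<m)

    raised-off : ∀ {i′} → i′ ≢ i → toℕ (raised i′) ≡ blockℕ p i′
    raised-off {i′} i′≢i = cong toℕ (updateAt-minimal i′ i (block p) i′≢i)

    raised-antitone : ∀ a c → toℕ a ≤ toℕ c → toℕ (raised c) ≤ toℕ (raised a)
    raised-antitone a c a≤c with a ≟ᶠ i | c ≟ᶠ i
    ... | yes refl | yes refl = ≤-refl
    ... | yes refl | no c≢i rewrite raised-off c≢i | raised-at =
      m≤n⇒m≤1+n (≤-trans (antiton p i c a≤c) (≤-reflexive bᵢ≡k))
    ... | no a≢i   | yes refl rewrite raised-off a≢i | raised-at =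
      left a (≤∧≢⇒< a≤c (a≢i ∘ toℕ-injective))
    ... | no a≢i   | no c≢i rewrite raised-off a≢i | raised-off c≢i = antiton p a c a≤c

    raise : Partition m N
    raise = mkPartition raised raised-antitone

    -- The raised block moves away from every column but `suc k`, so the gap of the moved letter
    -- only grows there.
    column-raise-≤ : ∀ {j} → j ≢ suc k → column raise j ≤ column p j
    column-raise-≤ {j} j≢k = sum-mono-≤ λ i′ → filled-mono {raise} {p} {j} {j} i′ (gap≤ i′)
      where
      gap≤ : ∀ i′ → gap m (blockℕ p i′) j ≤ gap m (blockℕ raise i′) j
      gap≤ i′ with i′ ≟ᶠ i
      ... | no i′≢i rewrite raised-off i′≢i = ≤-refl
      ... | yes refl rewrite raised-at | bᵢ≡k with j ≤? k
      ...   | yes j≤k = subst (_≤ gap m (suc k) j) (gap-≤ {m} j≤k) (gap-mono-≤ {m} (n≤1+n k) (inj₁ j≤k))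
      ...   | no j≰k  = subst (_≤ gap m (suc k) j) (gap-> {m} (≰⇒> j≰k)) (gap-mono-≤ {m} (n≤1+n k) (inj₂ (≤∧≢⇒< (≰⇒> j≰k) (j≢k ∘ sym))))

    column-raise-suc : column raise (suc k) ≤ suc (column p (suc k))
    column-raise-suc = sum-≤-suc i
      (λ i′ i′≢i → filled-mono {raise} {p} {suc k} {suc k} i′ (≤-reflexive (cong (λ b → gap m b (suc k)) (sym (raised-off i′≢i)))))
      (≤-trans (indicator≤1 (gap m (blockℕ raise i) (suc k) <? toℕ (u i))) (s≤s z≤n))

    raise-controlled : column p (suc k) < goal (suc k) → Controlled p → Controlled raise
    raise-controlled deficient ctrl j j<m 1≤j with j ≟ suc k
    ... | yes refl = inj₂ (≤-trans column-raise-suc deficient)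
    ... | no j≢k with ctrl j j<m 1≤j
    ...   | inj₂ c≤ = inj₂ (≤-trans (column-raise-≤ j≢k) c≤)
    ...   | inj₁ b< = inj₁ below
      where
      below : ∀ i′ → toℕ (raised i′) < j
      below i′ with i′ ≟ᶠ i
      -- The old block `k` is below `j`, and `j` is not `suc k`, so the new block is still below
      -- `j`.
      ... | yes refl rewrite raised-at = ≤∧≢⇒< (subst (_< j) bᵢ≡k (b< i)) (j≢k ∘ sym)
      ... | no i′≢i rewrite raised-off i′≢i = b< i′

    -- `Rightmost` does not ask that `p` be equitable, so it can serve as an invariant. If `q` kept
    -- `i` at or below `k`, its column `suc k` would be no fuller than the deficient one of `p`.
    raise-rightmost : column p (suc k) < goal (suc k) → Rightmost u p → Rightmost u raise
    raise-rightmost deficient right q eq i′ with i′ ≟ᶠ i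
    ... | no i′≢i rewrite raised-off i′≢i = right q eq i′
    ... | yes refl rewrite raised-at with suc k ≤? blockℕ q i
    ...   | yes k<qᵢ = k<qᵢ
    ...   | no k≮qᵢ  = contradiction
            (subst (λ j → column q j ≡ goal j) (toℕ-fromℕ< k<m) (equitable⇒column≡goal {q} eq (fromℕ< k<m)))
            (<⇒≢ (≤-<-trans (sum-mono-≤ λ a → filled-mono {q} {p} {suc k} {suc k} a (gap-mono-≤ {m} (right q eq a) (side a))) deficient))
      where
      side : ∀ a → suc k ≤ blockℕ p a ⊎ blockℕ q a < suc k
      -- From `p` to `q` no letter enters or crosses block `suc k` from the right: before `i` the
      -- blocks of `p` are already there or beyond, and from `i` on those of `q` stay below.
      side a with toℕ a <? toℕ i
      ... | yes a<i = inj₁ (left a a<i)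
      ... | no a≮i  = inj₂ (≤-<-trans (antiton q i a (≮⇒≥ a≮i)) (≰⇒> k≮qᵢ))

  -- Termination measure, iteration and conclusion.

  room : Partition m N → ℕ
  room p = sum (λ i → m ∸ blockℕ p i)

  room-raise : ∀ p i {k} (k<m : suc k < m) bᵢ≡k left → room (Raise.raise p i {k} k<m bᵢ≡k left) < room p
  room-raise p i {k} k<m bᵢ≡k left = sum-mono-< le i lt
    where
    open Raise p i k<m bᵢ≡k left
    lt : m ∸ toℕ (raised i) < m ∸ blockℕ p i
    lt rewrite raised-at | bᵢ≡k = ∸-monoʳ-< (n<1+n k) (<⇒≤ k<m)
    le : ∀ i′ → m ∸ toℕ (raised i′) ≤ m ∸ blockℕ p i′
    le i′ with i′ ≟ᶠ i
    ... | yes refl = <⇒≤ lt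
    ... | no i′≢i rewrite raised-off i′≢i = ≤-refl

  balance : ∀ p → Acc _<_ (room p) → Controlled p → Rightmost u p → Σ (Partition m N) λ q → Equitable u q × Rightmost u q
  balance p (acc rec) ctrl right with first-failure {m} (sated? p ∘ toℕ)
  ... | inj₁ sated = p , column≡goal⇒equitable {p} (sated⇒exact {p} ctrl sated) , right
  ... | inj₂ (j , ¬sated , below) = step (toℕ j) (toℕ<n j) ¬sated λ k k<j →
      subst (Sated p) (toℕ-fromℕ< (<-trans k<j (toℕ<n j)))
        (below (fromℕ< (<-trans k<j (toℕ<n j))) (subst (_< toℕ j) (sym (toℕ-fromℕ< (<-trans k<j (toℕ<n j)))) k<j))
    where
    step : ∀ j → j < m → ¬ Sated p j → (∀ k → k < j → Sated p k) → Σ (Partition m N) λ q → Equitable u q × Rightmost u q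
    step zero    _   ¬sated _     = contradiction tt ¬sated
    -- The search is for a failure of not being in block `k`, so it yields the first letter of that
    -- block.
    step (suc k) k<m ¬sated below with first-failure (λ i → ¬? (blockℕ p i ≟ k))
    ... | inj₁ empty = contradiction empty (deficient⇒block-nonempty {p} ctrl k<m (≰⇒> ¬sated) (below k ≤-refl))
    ... | inj₂ (i , ¬bᵢ≢k , before) with blockℕ p i ≟ k
    ...   | no bᵢ≢k  = contradiction bᵢ≢k ¬bᵢ≢k
    ...   | yes bᵢ≡k = balance raise (rec (room-raise p i k<m bᵢ≡k left))
                         (raise-controlled (≰⇒> ¬sated) ctrl) (raise-rightmost (≰⇒> ¬sated) right)
      where
      left : ∀ i′ → toℕ i′ < toℕ i → suc k ≤ blockℕ p i′
      -- Blocks decrease weakly, so an earlier letter is in block `k` or higher; `k` itself is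
      -- excluded as `i` is the first there.
      left i′ i′<i = ≤∧≢⇒< (≤-trans (≤-reflexive (sym bᵢ≡k)) (antiton p i′ i (<⇒≤ i′<i))) (before i′ i′<i ∘ sym)
      open Raise p i k<m bᵢ≡k left

  rightmost-equitable : Σ (Partition m N) λ p → Equitable u p × Rightmost u p
  -- With every letter in block 0, each column from 1 on is in the first case of `Controlled`, and 0
  -- bounds every block from below.
  rightmost-equitable = balance start (<-wellFounded (room start))
    (λ j _ 1≤j → inj₁ λ _ → subst (_< j) (sym 0̂≡0) 1≤j)
    (λ q _ i → ≤-trans (≤-reflexive 0̂≡0) z≤n)
    where
    0<m : 0 < m
    0<m = >-nonZero⁻¹ m
    0̂≡0 : toℕ (fromℕ< 0<m) ≡ 0
    0̂≡0 = toℕ-fromℕ< 0<m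
    start : Partition m N
    start = mkPartition (λ _ → fromℕ< 0<m) (λ _ _ _ → ≤-refl)

theorem4p4 : (m N : ℕ) → .{{_ : NonZero m}} → 0 < N → (u : Word m N) →
    Σ (Partition m N) (λ p → (Equitable u p × Rightmost u p) ×
    ((q : Partition m N) → Equitable u q → Rightmost u q → (i : Fin N) → block q i ≡ block p i))
theorem4p4 m N _ u with rightmost-equitable u
... | p , eq , right = p , (eq , right) , λ q eq′ right′ i →
  toℕ-injective (≤-antisym (right′ p eq i) (right q eq′ i))
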